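{- For every directed graph $G$ and all $S,R\in \mathrm{Mod}(G)$, one has $A^-_G[S]=A^-_G[R]$.
   Context: A graph is a directed graph $G=\langle G,A_G\rangle$ with vertex set $G$ (loops allowed, $G$ possibly infinite) and $A_G\subseteq G\times G$. For $x\in G$ put $A_G(x)=\{y\in G\mid (x,y)\in A_G\}$ and $A^-_G(x)=\{y\in G\mid x\in A_G(y)\}$. For $X\subseteq G$ put $A_G(X)=\bigcup_{x\in X}A_G(x)$, $A^-_G(X)=\bigcup_{x\in X}A^-_G(x)$ and $A^-_G[X]=X\cup A^-_G(X)$. A semikernel of $G$ is a set $S\subseteq G$ such that $A_G(S)\subseteq A^-_G(S)\subseteq G\setminus S$; $SK(G)$ denotes the set of all semikernels of $G$. $\mathrm{Mod}(G)$ is the set of all $S\in SK(G)$ such that (i) $A^-_G(A^-_G[S])\subseteq A^-_G[S]$, and (ii) there is no $R\in SK(G)$ with $A^-_G(A^-_G[R])\subseteq A^-_G[R]$ and $A^-_G[S]\subsetneq A^-_G[R]$. -}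

module Defs where

open import Data.Product using (_×_; ∃-syntax)
open import Level using (Level; suc)
open import Relation.Binary using (Rel)
open import Relation.Nullary using (¬_)
open import Relation.Unary using (Pred; _∈_; _⊆_; _⊂_; _∪_; ∁)

-- Vertices, arcs and sets of vertices share one universe level, so that every
-- set of vertices definable from G and given sets is again a set of vertices.

record Digraph (ℓ : Level) : Set (suc ℓ) where
  field
    Vertex : Set ℓ
    Arc    : Rel Vertex ℓ

module _ {ℓ : Level} (G : Digraph ℓ) where
  open Digraph G

  VertexSet : Set (suc ℓ)
  VertexSet = Pred Vertex ℓ

  out : Vertex → VertexSet
  out x = λ y → Arc x y

  inn : Vertex → VertexSet
  inn x = λ y → x ∈ out y

  -- A⁺ X, A⁻ X and A⁻[ X ] are A_G(X), A⁻_G(X) and A⁻_G[X].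

  A⁺ : VertexSet → VertexSet
  A⁺ X = λ y → ∃[ x ] (x ∈ X × y ∈ out x)

  A⁻ : VertexSet → VertexSet
  A⁻ X = λ y → ∃[ x ] (x ∈ X × y ∈ inn x)

  A⁻[_] : VertexSet → VertexSet
  A⁻[ X ] = X ∪ A⁻ X

  SK : Pred VertexSet ℓ
  SK S = (A⁺ S ⊆ A⁻ S) × (A⁻ S ⊆ ∁ S)

  InClosed : Pred VertexSet ℓ
  InClosed S = A⁻ A⁻[ S ] ⊆ A⁻[ S ]

  Mod : Pred VertexSet (suc ℓ)
  Mod S = S ∈ SK
        × InClosed S
        × ¬ (∃[ R ] (R ∈ SK × InClosed R × A⁻[ S ] ⊂ A⁻[ R ]))

{-# OPTIONS --safe #-}
-- If S and R are semikernels with in-closed A⁻[S] and A⁻[R], then S ∪ (R ∖ A⁻[S])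
-- is a semikernel Q with A⁻[Q] = A⁻[S] ∪ A⁻[R], which is again in-closed.
-- Maximality of A⁻[S] therefore forces A⁻[R] ⊆ A⁻[S].
module Submission where

open import Defs
open import Level using (Level)
open import Axiom.ExcludedMiddle using (ExcludedMiddle)
open import Data.Empty using (⊥-elim)
open import Data.Product using (_,_)
open import Data.Sum using (inj₁; inj₂; [_,_]′)
open import Relation.Nullary using (yes; no)
open import Relation.Unary using (_∈_; _⊆_; _∪_; _∖_; ∁; _≐_)

module _ {ℓ : Level} (em : ExcludedMiddle ℓ) (G : Digraph ℓ) where
  private
    A[_] : VertexSet G → VertexSet G
    A[_] = A⁻[_] G

  join : VertexSet G → VertexSet G → VertexSet G
  join S R = S ∪ (R ∖ A[ S ])

  -- Deleting `A[ S ]` from `R` removes both the tails and the heads of arcs between `R` and `S`;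
  -- in-closedness ensures that the vertices of `R` needed for absorption survive.
  join-SK : ∀ {S R} → S ∈ SK G → R ∈ SK G → InClosed G S → join S R ∈ SK G
  join-SK {S} {R} (S⁺⊆S⁻ , S⁻⊆∁S) (R⁺⊆R⁻ , R⁻⊆∁R) closed = absorbing , independent
    where
    absorbing : A⁺ G (join S R) ⊆ A⁻ G (join S R)
    absorbing (x , inj₁ x∈S , x→y) with S⁺⊆S⁻ (x , x∈S , x→y)
    ... | s , s∈S , y→s = s , inj₁ s∈S , y→s
    absorbing {y} (x , inj₂ (x∈R , x∉A[S]) , x→y) with R⁺⊆R⁻ (x , x∈R , x→y)
    ... | r , r∈R , y→r = r , inj₂ (r∈R , r∉A[S]) , y→r
      -- Along the walk x → y → r, closedness used twice would pull `A[ S ]` back from `r` to `y`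
      -- and then to `x`.
      where r∉A[S] = λ r∈A[S] → x∉A[S] (closed (y , closed (r , r∈A[S] , y→r) , x→y))

    independent : A⁻ G (join S R) ⊆ ∁ (join S R)
    independent (x , inj₁ x∈S , y→x) (inj₁ y∈S) = S⁻⊆∁S (x , x∈S , y→x) y∈S
    independent (x , inj₁ x∈S , y→x) (inj₂ (_ , y∉A[S])) = y∉A[S] (inj₂ (x , x∈S , y→x))
    -- An arc from `S` to `x` forces an arc from `x` back into `S`, so `x` would have been deleted.
    independent {y} (x , inj₂ (_ , x∉A[S]) , y→x) (inj₁ y∈S) =
      x∉A[S] (inj₂ (S⁺⊆S⁻ (y , y∈S , y→x)))
    independent (x , inj₂ (x∈R , _) , y→x) (inj₂ (y∈R , _)) = R⁻⊆∁R (x , x∈R , y→x) y∈R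

  ⊆-joinˡ : ∀ {S R} → A[ S ] ⊆ A[ join S R ]
  ⊆-joinˡ (inj₁ y∈S) = inj₁ (inj₁ y∈S)
  ⊆-joinˡ (inj₂ (s , s∈S , y→s)) = inj₂ (s , inj₁ s∈S , y→s)

  -- A vertex of `R` that was deleted lies in `A[ S ]`, and by closedness so do its in-neighbours;
  -- excluded middle decides which vertices were deleted.
  ⊆-joinʳ : ∀ {S R} → InClosed G S → A[ R ] ⊆ A[ join S R ]
  ⊆-joinʳ {S} {R} closed (inj₁ y∈R) with em {_ ∈ A[ S ]}
  ... | yes y∈A[S] = ⊆-joinˡ {S} {R} y∈A[S]
  ... | no  y∉A[S] = inj₁ (inj₂ (y∈R , y∉A[S]))
  ⊆-joinʳ {S} {R} closed (inj₂ (r , r∈R , y→r)) with em {A[ S ] r}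
  ... | yes r∈A[S] = ⊆-joinˡ {S} {R} (closed (r , r∈A[S] , y→r))
  ... | no  r∉A[S] = inj₂ (r , inj₂ (r∈R , r∉A[S]) , y→r)

  join-⊆ : ∀ {S R} → A[ join S R ] ⊆ A[ S ] ∪ A[ R ]
  join-⊆ (inj₁ (inj₁ y∈S)) = inj₁ (inj₁ y∈S)
  join-⊆ (inj₁ (inj₂ (y∈R , _))) = inj₂ (inj₁ y∈R)
  join-⊆ (inj₂ (x , inj₁ x∈S , y→x)) = inj₁ (inj₂ (x , x∈S , y→x))
  join-⊆ (inj₂ (x , inj₂ (x∈R , _) , y→x)) = inj₂ (inj₂ (x , x∈R , y→x))

  join-InClosed : ∀ {S R} → InClosed G S → InClosed G R → InClosed G (join S R)
  join-InClosed {S} {R} closedS closedR (x , x∈Q , y→x) =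
    [ (λ x∈A[S] → ⊆-joinˡ {S} {R} (closedS (x , x∈A[S] , y→x)))
    , (λ x∈A[R] → ⊆-joinʳ {S} {R} closedS (closedR (x , x∈A[R] , y→x)))
    ]′ (join-⊆ {S} {R} x∈Q)

  -- Maximal becomes greatest because joins exist: a vertex of `A[ R ]` outside `A[ S ]` would make
  -- `A[ join S R ]` strictly larger than `A[ S ]`. Maximality only refutes this, hence the case
  -- split by `em`.
  Mod-greatest : ∀ {S R} → S ∈ Mod G → R ∈ SK G → InClosed G R → A[ R ] ⊆ A[ S ]
  Mod-greatest {S} {R} (skS , closedS , maximal) skR closedR {y} y∈A[R] with em {A[ S ] y}
  ... | yes y∈A[S] = y∈A[S]
  ... | no  y∉A[S] = ⊥-elim (maximal
    ( join S R , join-SK skS skR closedS , join-InClosed {S} {R} closedS closedR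
    , ⊆-joinˡ {S} {R} , λ Q⊆S → y∉A[S] (Q⊆S (⊆-joinʳ {S} {R} closedS y∈A[R]))))

theorem3p10 : {ℓ : Level} → ExcludedMiddle ℓ → (G : Digraph ℓ) (S R : VertexSet G) →
    S ∈ Mod G → R ∈ Mod G → A⁻[_] G S ≐ A⁻[_] G R
theorem3p10 em G S R S∈Mod@(skS , closedS , _) R∈Mod@(skR , closedR , _) =
  Mod-greatest em G {R} {S} R∈Mod skS closedS , Mod-greatest em G {S} {R} S∈Mod skR closedR
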